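{- In the Granularity-Change Caching Problem with block size $B$, for any deterministic online replacement policy that requires $a$ consecutive distinct accesses to a block to load all of it, the competitive ratio of that policy is at least $$\frac{a\,(k-h+1) + B\,(h-a)}{k-h+1},$$ where $k$ is the size of the online cache and $h$ is the size of the optimal (offline) cache.
   Context: Granularity-Change (GC) Caching model: items have unit size, and the universe of items is partitioned into disjoint blocks, each containing at most $B$ items. A cache of size $k$ holds at most $k$ items at any time and starts empty. Requests (accesses) to items arrive one at a time. If the requested item is in the cache (a hit), the request costs $0$. If it is not (a miss), the cache pays cost $1$ and loads any chosen subset of the block of the requested item, so long as the subset contains the requested item; individual items may be evicted at no cost, and must be evicted as necessary so that at most $k$ items are in the cache. The cost of a trace is its number of misses. Online versus offline: an online policy makes its decisions as requests arrive, without knowledge of future requests; the optimal cache is an offline cache of size $h$ that sees the whole trace in advance and minimizes the cost. The competitive ratio of an online policy of cache size $k$ against the optimal cache of size $h$ is the worst-case asymptotic ratio of costs: the infimum of all $c$ for which there is a constant $d$ such that (online cost on $\sigma$) $\le c\cdot$ (optimal cost on $\sigma$) $+\,d$ for all traces $\sigma$ and all partitions of items into blocks of at most $B$ items. The parameter $a$: the number of distinct consecutive accesses to a block before the policy loads the entire block. Precisely, whenever a block that has not been accessed before is accessed consecutively, each access being to an item of the block that the policy has not yet loaded, and this is continued until no such item exists, exactly $a$ accesses occur (so $1\le a\le B$). Standing assumption: caches are much larger than the block size ($k \gg B$).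
   Formalization: The printed bound is proved when B divides k-h+1 (it fails otherwise: for a=B=2, h=k>2, item LRU has ratio at most k); in general it is proved with k-h+1 replaced by any multiple of B that is at least k-h+1. It is assumed that a ≤ h ≤ k. -}

module Defs where

open import Data.Integer.Base using (+_)
open import Data.List.Base using (List; []; _∷_; _++_; _∷ʳ_; length)
open import Data.List.Membership.Propositional using (_∈_; _∉_)
open import Data.List.Relation.Binary.Subset.Propositional using (_⊆_)
open import Data.List.Relation.Unary.All using (All)
open import Data.List.Relation.Unary.Unique.Propositional using (Unique)
open import Data.Nat.Base using (ℕ; _+_; _≤_)
open import Data.Product.Base using (∃; ∃₂; _×_; proj₁)
import Data.Rational.Base as ℚ
open import Data.Rational.Base using (ℚ)
open import Data.Sum.Base using (_⊎_)
open import Relation.Binary.PropositionalEquality using (_≡_; _≢_)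
open import Relation.Nullary.Negation.Core using (¬_)

-- The universe of items must be infinite: the competitive ratio is asymptotic,
-- and the lower bound keeps requesting blocks never seen before.
Item : Set
Item = ℕ

-- A partition is given by block labels; a label carried by no item is not a block.
record Partition (B : ℕ) : Set where
  field
    blockOf    : Item → ℕ
    block-size : ∀ b xs → Unique xs → All (λ x → blockOf x ≡ b) xs → length xs ≤ B

open Partition public

FullBlock : ∀ {B} → Partition B → ℕ → Set
FullBlock {B} p b = ∃ λ xs → Unique xs × All (λ x → blockOf p x ≡ b) xs × length xs ≡ B

-- The set of cached items, listed in any order.  A duplicate only wastes a slot,
-- so lists of length at most k represent exactly the sets of at most k items.
Cache : Set
Cache = List Item

-- Step p k C r C′ c : a cache of size k holding C serves the request r at cost c
-- and then holds C′.  Evictions are free, on hits as well as on misses.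
data Step {B} (p : Partition B) (k : ℕ) (C : Cache) (r : Item) (C′ : Cache) : ℕ → Set where
  hit  : r ∈ C → C′ ⊆ C → length C′ ≤ k → Step p k C r C′ 0
  miss : r ∉ C → r ∈ C′ → (∀ {x} → x ∈ C′ → x ∈ C ⊎ blockOf p x ≡ blockOf p r) →
         length C′ ≤ k → Step p k C r C′ 1

data Schedule {B} (p : Partition B) (k : ℕ) : Cache → List Item → ℕ → Set where
  []  : ∀ {C} → Schedule p k C [] 0
  _∷_ : ∀ {C r C′ c σ n} → Step p k C r C′ c → Schedule p k C′ σ n →
        Schedule p k C (r ∷ σ) (c + n)

OptimalCost : ∀ {B} → Partition B → ℕ → List Item → ℕ → Set
OptimalCost p h σ n = Schedule p h [] σ n × (∀ {n′} → Schedule p h [] σ n′ → n ≤ n′)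

-- A deterministic online policy: the cache is a function of the partition and of
-- the requests served so far (oldest first).
record OnlinePolicy (B k : ℕ) : Set where
  field
    cache : Partition B → List Item → Cache
    start : ∀ p → cache p [] ≡ []
    step  : ∀ p w r → ∃ λ c → Step p k (cache p w) r (cache p (w ∷ʳ r)) c

  costAfter : Partition B → List Item → List Item → ℕ
  costAfter p w []      = 0
  costAfter p w (r ∷ σ) = proj₁ (step p w r) + costAfter p (w ∷ʳ r) σ

  cost : Partition B → List Item → ℕ
  cost p σ = costAfter p [] σ

  -- x was in the cache at some moment of the history w.
  Loaded : Partition B → List Item → Item → Set
  Loaded p w x = ∃₂ λ u v → w ≡ u ++ v × x ∈ cache p u

  -- After the history w, the requests are to not-yet-loaded items of block b,
  -- until no such item is left.
  data LoadingRun (p : Partition B) (b : ℕ) (w : List Item) : List Item → Set where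
    done   : (∀ x → blockOf p x ≡ b → Loaded p w x) → LoadingRun p b w []
    access : ∀ {r rs} → blockOf p r ≡ b → ¬ Loaded p w r →
             LoadingRun p b (w ∷ʳ r) rs → LoadingRun p b w (r ∷ rs)

  -- Only blocks of exactly B items are constrained: a block with fewer than a items
  -- cannot receive a such accesses.
  LoadsBlockAfter : ℕ → Set
  LoadsBlockAfter a = ∀ p b w rs → FullBlock p b → All (λ x → blockOf p x ≢ b) w →
                      LoadingRun p b w rs → length rs ≡ a

open OnlinePolicy public

fromℕ : ℕ → ℚ
fromℕ n = + n ℚ./ 1

Competitive : ∀ {B k} → OnlinePolicy B k → ℕ → ℚ → Set
Competitive P h c = ∃ λ d → ∀ p σ n → OptimalCost p h σ n →
                    fromℕ (cost P p σ) ℚ.≤ c ℚ.* fromℕ n ℚ.+ d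

-- x is a lower bound of the c for which P is c-competitive, that is, x is at most
-- their infimum.  These c form an upward closed set, so ranging over rational
-- instead of real c does not change the infimum (∞ if there is no such c).
CompetitiveRatio≥ : ∀ {B k} → OnlinePolicy B k → ℕ → ℚ → Set
CompetitiveRatio≥ P h x = ∀ c → Competitive P h c → x ℚ.≤ c

{-# OPTIONS --safe #-}
module Submission where

-- Fix blocks of B consecutive items, let m = q B, and repeat the following phase.  Request q new
-- blocks, each until the policy has loaded it: it misses a times per block.  Then make h - a
-- requests, each to an item missing from the policy's cache, among the h items cached offline at
-- the start of the phase and the m items of the new blocks; these are h + m > k items, so there
-- always is one.  An offline cache that knows these h - a requests misses only once per new
-- block: with that miss it loads the items about to be requested and those needed later.  It
-- always holds at most a items for the current run and h - a for the final requests, hits on all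
-- of the latter, and ends the phase with h items again.  So a phase costs the policy
-- q a + h - a and the offline cache q.

open import Defs
open import Data.Integer.Base using (+_)
open import Data.Nat.Base using (ℕ; suc; _+_; _*_; _∸_; _≤_; NonZero)
open import Data.Nat.Divisibility using (_∣_)
open import Data.Product.Base using (_×_)
open import Data.Rational.Base using (_/_)

import Data.Integer.Base as ℤ
import Data.Integer.Properties as ℤ
open import Data.List.Base
  using (List; []; _∷_; _++_; _∷ʳ_; initLast; _∷ʳ′_; length; filter; take; drop;
         deduplicate; applyUpTo; upTo)
open import Data.List.Membership.Propositional using (_∈_; _∉_; lose; find)
open import Data.List.Membership.Propositional.Properties
open import Data.List.Properties
  using (++-assoc; ++-identityʳ; ∷ʳ-++; length-++; length-take; length-applyUpTo; length-upTo;
         upTo-∷ʳ; filter-all; filter-notAll; length-filter; take++drop≡id)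
open import Data.List.Relation.Binary.Subset.Propositional using (_⊆_)
open import Data.List.Relation.Binary.Subset.Propositional.Properties using (xs⊆xs++ys; filter-⊆)
open import Data.List.Relation.Unary.All as All using (All; []; _∷_)
import Data.List.Relation.Unary.All.Properties as All
open import Data.List.Relation.Unary.AllPairs using ([]; _∷_)
open import Data.List.Relation.Unary.Any using (here; there)
open import Data.List.Relation.Unary.Unique.Propositional using (Unique)
import Data.List.Relation.Unary.Unique.Propositional.Properties as Unique
open import Data.Nat.Base using (zero; z≤n; s≤s; s≤s⁻¹; _<_; _⊓_)
open import Data.Nat.Divisibility using (divides)
import Data.Nat.DivMod as ℕ
open import Data.Nat.Properties
open import Data.Nat.Solver using (module +-*-Solver)
open import Data.Product.Base using (∃; ∃₂; _,_; proj₁; proj₂)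
import Data.Rational.Base as ℚ
open import Data.Rational.Base using (ℚ; 0ℚ; 1ℚ; ↥_; ↧_; ↧ₙ_; toℚᵘ)
import Data.Rational.Properties as ℚ
import Data.Rational.Solver as ℚ
import Data.Rational.Unnormalised.Base as ℚᵘ
open import Data.Rational.Unnormalised.Base using (mkℚᵘ; *≡*; *<*; *≤*)
import Data.Rational.Unnormalised.Properties as ℚᵘ
open import Data.Sum.Base using (_⊎_; inj₁; inj₂; [_,_]′)
open import Function.Base using (_∘_; id)
open import Relation.Binary.PropositionalEquality
open import Relation.Nullary.Decidable
  using (Dec; yes; no; ¬?; map′; _⊎-dec_; decidable-stable; ¬¬-excluded-middle)
open import Relation.Nullary.Negation.Core using (¬_; contradiction)
open import Relation.Unary using (Decidable)
open import Data.List.Membership.DecPropositional _≟_ using (_∈?_; _∉?_)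
open import Data.List.Relation.Unary.Unique.DecPropositional.Properties _≟_ using (deduplicate-!)

-- Least witnesses and linear bounds over the rationals

-- `Q` is not assumed decidable, so whether `Q 0` holds can only be asked under double negation; if
-- it fails, the search continues with `Q` shifted by one.
least : ∀ {Q : ℕ → Set} n → Q n → ¬ ¬ (∃ λ m → m ≤ n × Q m × (∀ {l} → Q l → m ≤ l))
least zero    q none = none (0 , z≤n , q , λ _ → z≤n)
least {Q} (suc n) q none = ¬¬-excluded-middle λ where
  (yes q₀) → none (0 , z≤n , q₀ , λ _ → z≤n)
  (no ¬q₀) → least n q λ (m , m≤n , qm , min) →
    none (suc m , s≤s m≤n , qm ,
          λ { {zero} q₀ → contradiction q₀ ¬q₀ ; {suc _} ql → s≤s (min ql) })

toℚᵘ-fromℕ : ∀ n → toℚᵘ (fromℕ n) ℚᵘ.≃ mkℚᵘ (+ n) 0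
toℚᵘ-fromℕ n = ℚ.toℚᵘ-fromℚᵘ (mkℚᵘ (+ n) 0)

fromℕ-+ : ∀ m n → fromℕ (m + n) ≡ fromℕ m ℚ.+ fromℕ n
fromℕ-+ m n = ℚ.toℚᵘ-injective (begin-equality
  toℚᵘ (fromℕ (m + n))
    ≃⟨ toℚᵘ-fromℕ (m + n) ⟩
  mkℚᵘ (+ (m + n)) 0
    ≃⟨ *≡* (cong (ℤ._* + 1)
         (sym (cong₂ ℤ._+_ (ℤ.*-identityʳ (+ m)) (ℤ.*-identityʳ (+ n))))) ⟩
  mkℚᵘ (+ m) 0 ℚᵘ.+ mkℚᵘ (+ n) 0
    ≃⟨ ℚᵘ.+-cong (toℚᵘ-fromℕ m) (toℚᵘ-fromℕ n) ⟨
  toℚᵘ (fromℕ m) ℚᵘ.+ toℚᵘ (fromℕ n)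
    ≃⟨ ℚ.toℚᵘ-homo-+ (fromℕ m) (fromℕ n) ⟨
  toℚᵘ (fromℕ m ℚ.+ fromℕ n) ∎)
  where open ℚᵘ.≤-Reasoning

fromℕ-* : ∀ m n → fromℕ (m * n) ≡ fromℕ m ℚ.* fromℕ n
fromℕ-* m n = ℚ.toℚᵘ-injective (begin-equality
  toℚᵘ (fromℕ (m * n))               ≃⟨ toℚᵘ-fromℕ (m * n) ⟩
  mkℚᵘ (+ (m * n)) 0                 ≃⟨ *≡* (cong (ℤ._* + 1) (ℤ.pos-* m n)) ⟩
  mkℚᵘ (+ m) 0 ℚᵘ.* mkℚᵘ (+ n) 0     ≃⟨ ℚᵘ.*-cong (toℚᵘ-fromℕ m) (toℚᵘ-fromℕ n) ⟨
  toℚᵘ (fromℕ m) ℚᵘ.* toℚᵘ (fromℕ n) ≃⟨ ℚ.toℚᵘ-homo-* (fromℕ m) (fromℕ n) ⟨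
  toℚᵘ (fromℕ m ℚ.* fromℕ n) ∎)
  where open ℚᵘ.≤-Reasoning

fromℕ-mono-≤ : ∀ {m n} → m ≤ n → fromℕ m ℚ.≤ fromℕ n
fromℕ-mono-≤ {m} {n} m≤n = ℚ.toℚᵘ-cancel-≤ (begin
  toℚᵘ (fromℕ m) ≃⟨ toℚᵘ-fromℕ m ⟩
  mkℚᵘ (+ m) 0   ≤⟨ *≤* (ℤ.*-monoʳ-≤-nonNeg (+ 1) (ℤ.+≤+ m≤n)) ⟩
  mkℚᵘ (+ n) 0   ≃⟨ toℚᵘ-fromℕ n ⟨
  toℚᵘ (fromℕ n) ∎)
  where open ℚᵘ.≤-Reasoning

fromℕ-nonNeg : ∀ n → ℚ.NonNegative (fromℕ n)
fromℕ-nonNeg n = ℚ.normalize-nonNeg n 1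

fromℕ-pos : ∀ n .{{_ : NonZero n}} → ℚ.Positive (fromℕ n)
fromℕ-pos n = ℚ.normalize-pos n 1

i/n*n≡i : ∀ i n .{{_ : NonZero n}} → (+ i / n) ℚ.* fromℕ n ≡ fromℕ i
i/n*n≡i i n@(suc n-1) = ℚ.toℚᵘ-injective (begin-equality
  toℚᵘ ((+ i / n) ℚ.* fromℕ n)
    ≃⟨ ℚ.toℚᵘ-homo-* (+ i / n) (fromℕ n) ⟩
  toℚᵘ (+ i / n) ℚᵘ.* toℚᵘ (fromℕ n)
    ≃⟨ ℚᵘ.*-cong (ℚ.toℚᵘ-fromℚᵘ (mkℚᵘ (+ i) n-1)) (toℚᵘ-fromℕ n) ⟩
  mkℚᵘ (+ i) n-1 ℚᵘ.* mkℚᵘ (+ n) 0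
    ≃⟨ *≡* (trans (ℤ.*-identityʳ _) (cong (λ k → + i ℤ.* + k) (sym (*-identityʳ n)))) ⟩
  mkℚᵘ (+ i) 0
    ≃⟨ toℚᵘ-fromℕ i ⟨
  toℚᵘ (fromℕ i) ∎)
  where open ℚᵘ.≤-Reasoning

i≤∣i∣ : ∀ i → i ℤ.≤ + ℤ.∣ i ∣
i≤∣i∣ (+ _)      = ℤ.≤-refl
i≤∣i∣ ℤ.-[1+ _ ] = ℤ.-≤+

-- Denominators are at least 1, so a rational is at most the absolute value of its numerator.
<-fromℕ : ∀ p → p ℚ.< fromℕ (suc ℤ.∣ ↥ p ∣)
<-fromℕ p@record{} =
  ℚ.toℚᵘ-cancel-< (ℚᵘ.<-respʳ-≃ (ℚᵘ.≃-sym (toℚᵘ-fromℕ n)) (*<* (begin-strict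
    ↥ p ℤ.* + 1    ≡⟨ ℤ.*-identityʳ (↥ p) ⟩
    ↥ p            ≤⟨ i≤∣i∣ (↥ p) ⟩
    + ℤ.∣ ↥ p ∣    <⟨ ℤ.+<+ (n<1+n _) ⟩
    + n            ≤⟨ ℤ.+≤+ (m≤m*n n (↧ₙ p)) ⟩
    + (n * ↧ₙ p)   ≡⟨ ℤ.pos-* n (↧ₙ p) ⟩
    + n ℤ.* ↧ p ∎)))
  where
  open ℤ.≤-Reasoning
  n : ℕ
  n = suc ℤ.∣ ↥ p ∣

-- If `δ` were positive, a natural number above `d / δ` would violate the bound.
archimedean : ∀ {δ} d → (∀ n → fromℕ n ℚ.* δ ℚ.≤ d) → δ ℚ.≤ 0ℚ
archimedean {δ} d bounded = ℚ.≮⇒≥ λ 0<δ →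
  let instance
        δ>0 = ℚ.positive 0<δ
        δ≢0 = ℚ.pos⇒nonZero δ
      n = suc ℤ.∣ ↥ (d ℚ.* ℚ.1/ δ) ∣
  in ℚ.<-irrefl refl (begin-strict
       d                      ≡⟨ ℚ.*-identityʳ d ⟨
       d ℚ.* 1ℚ               ≡⟨ cong (d ℚ.*_) (ℚ.*-inverseˡ δ) ⟨
       d ℚ.* (ℚ.1/ δ ℚ.* δ)   ≡⟨ ℚ.*-assoc d (ℚ.1/ δ) δ ⟨
       d ℚ.* ℚ.1/ δ ℚ.* δ     <⟨ ℚ.*-monoˡ-<-pos δ (<-fromℕ (d ℚ.* ℚ.1/ δ)) ⟩
       fromℕ n ℚ.* δ          ≤⟨ bounded n ⟩
       d ∎)
  where open ℚ.≤-Reasoning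

-- Repeating a phase `t` times makes the additive constants negligible: `t` times the difference of
-- `e` and `c * q` stays below `c * h + d`, which does not depend on `t`.
slope-≤ : ∀ c d e q h → (∀ t → fromℕ (t * e) ℚ.≤ c ℚ.* fromℕ (h + t * q) ℚ.+ d) →
          fromℕ e ℚ.≤ c ℚ.* fromℕ q
slope-≤ c d e q h bounded = subst₂ ℚ._≤_
  (solve 2 (λ x y → x :- y :+ y := x) refl (fromℕ e) (c ℚ.* fromℕ q))
  (ℚ.+-identityˡ _)
  (ℚ.+-monoˡ-≤ (c ℚ.* fromℕ q) (archimedean (c ℚ.* fromℕ h ℚ.+ d) λ t →
    subst₂ ℚ._≤_ (lhs t) (rhs t) (ℚ.+-monoˡ-≤ (ℚ.- (c ℚ.* fromℕ t ℚ.* fromℕ q)) (bounded t))))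
  where
  open ℚ.+-*-Solver
  lhs : ∀ t → fromℕ (t * e) ℚ.- c ℚ.* fromℕ t ℚ.* fromℕ q ≡
              fromℕ t ℚ.* (fromℕ e ℚ.- c ℚ.* fromℕ q)
  lhs t rewrite fromℕ-* t e =
    solve 4 (λ t e c q → t :* e :- c :* t :* q := t :* (e :- c :* q)) refl
      (fromℕ t) (fromℕ e) c (fromℕ q)
  rhs : ∀ t → c ℚ.* fromℕ (h + t * q) ℚ.+ d ℚ.- c ℚ.* fromℕ t ℚ.* fromℕ q ≡ c ℚ.* fromℕ h ℚ.+ d
  rhs t rewrite fromℕ-+ h (t * q) | fromℕ-* t q =
    solve 5 (λ t c q h d → c :* (h :+ t :* q) :+ d :- c :* t :* q := c :* h :+ d) refl
      (fromℕ t) c (fromℕ q) (fromℕ h) d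

-- Duplicate-free lists as finite sets

-- Removing the head of `xs` from `ys` shortens `ys` and keeps all of the tail, which does not
-- contain the head.
Unique-⊆⇒length-≤ : {xs ys : List ℕ} → Unique xs → xs ⊆ ys → length xs ≤ length ys
Unique-⊆⇒length-≤ [] _ = z≤n
Unique-⊆⇒length-≤ {x ∷ xs} {ys} (x≢xs ∷ xs!) xs⊆ys = ≤-<-trans
  (Unique-⊆⇒length-≤ xs! λ z∈xs →
    ∈-filter⁺ ≢x? (xs⊆ys (there z∈xs)) λ { refl → All.lookup x≢xs z∈xs refl })
  (filter-notAll ≢x? ys (lose (xs⊆ys (here refl)) λ x≢x → x≢x refl))
  where
  ≢x? : Decidable (_≢ x)
  ≢x? y = ¬? (y ≟ x)

infixl 6 _∖_

_∖_ : List ℕ → List ℕ → List ℕ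
xs ∖ ys = filter (_∉? ys) xs

⊆-++-∖ : ∀ xs ys → xs ⊆ ys ++ (xs ∖ ys)
⊆-++-∖ xs ys {x} x∈xs with x ∈? ys
... | yes x∈ys = ∈-++⁺ˡ x∈ys
... | no  x∉ys = ∈-++⁺ʳ ys (∈-filter⁺ (_∉? ys) x∈xs x∉ys)

Unique-++-∖ : ∀ {xs ys zs} → Unique xs → Unique zs → zs ⊆ ys ∖ xs → Unique (xs ++ zs)
Unique-++-∖ {xs} {ys} xs! zs! zs⊆ = Unique.++⁺ xs! zs!
  λ (v∈xs , v∈zs) → proj₂ (∈-filter⁻ (_∉? xs) {xs = ys} (zs⊆ v∈zs)) v∈xs

take-⊆ : ∀ n (xs : List ℕ) → take n xs ⊆ xs
take-⊆ n xs = subst (take n xs ⊆_) (take++drop≡id n xs) (xs⊆xs++ys (take n xs) (drop n xs))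

-- Chooses the rest of the offline cache for the end of a phase: `xs` will be the last run, `ys` the
-- final requests, which may repeat, `zs` the candidates for them, and `n` the cache size. First
-- `vs` adds the requested items, then `ps` pads with arbitrary candidates.
complete : ∀ {xs zs} ys n → Unique xs → Unique zs → ys ⊆ zs →
           length xs + length ys ≤ n → n ≤ length zs →
           ∃ λ rs → Unique (xs ++ rs) × ys ⊆ xs ++ rs × rs ⊆ zs × length (xs ++ rs) ≡ n
complete {xs} {zs} ys n xs! zs! ys⊆zs ≤n n≤ =
  vs ++ ps
  , subst Unique assoc (Unique-++-∖ {ys = zs} us! (Unique.take⁺ j (Unique.filter⁺ (_∉? us) zs!))
                                    (take-⊆ j (zs ∖ us)))
  , (λ y∈ys → subst (_ ∈_) assoc (∈-++⁺ˡ (ys⊆us y∈ys)))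
  , (λ x∈ → [ ys⊆zs ∘ vs⊆ys , filter-⊆ (_∉? us) zs ∘ take-⊆ j (zs ∖ us) ]′ (∈-++⁻ vs x∈))
  , (begin-equality
      length (xs ++ vs ++ ps) ≡⟨ cong length assoc ⟨
      length (us ++ ps)       ≡⟨ length-++ us ⟩
      length us + length ps   ≡⟨ cong (_+_ (length us)) (length-take j (zs ∖ us)) ⟩
      length us + j ⊓ length (zs ∖ us)
        ≡⟨ cong (_+_ (length us)) (m≤n⇒m⊓n≡m (m≤n+o⇒m∸n≤o n (length us) n≤′)) ⟩
      length us + (n ∸ length us) ≡⟨ m+[n∸m]≡n us≤n ⟩
      n ∎)
  where
  open ≤-Reasoning
  vs us ps : List ℕ
  vs = deduplicate _≟_ (ys ∖ xs)
  us = xs ++ vs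
  j : ℕ
  j = n ∸ length us
  ps = take j (zs ∖ us)
  assoc : us ++ ps ≡ xs ++ vs ++ ps
  assoc = ++-assoc xs vs ps
  vs⊆ : vs ⊆ ys ∖ xs
  vs⊆ = ∈-deduplicate⁻ _≟_ (ys ∖ xs)
  vs⊆ys : vs ⊆ ys
  vs⊆ys = filter-⊆ (_∉? xs) ys ∘ vs⊆
  us! : Unique us
  us! = Unique-++-∖ {ys = ys} xs! (deduplicate-! (ys ∖ xs)) vs⊆
  ys⊆us : ys ⊆ us
  ys⊆us y∈ys with ∈-++⁻ xs (⊆-++-∖ ys xs y∈ys)
  ... | inj₁ y∈xs = ∈-++⁺ˡ y∈xs
  ... | inj₂ y∈   = ∈-++⁺ʳ xs (∈-deduplicate⁺ _≟_ y∈)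
  us≤n : length us ≤ n
  us≤n = begin
    length us             ≡⟨ length-++ xs ⟩
    length xs + length vs
      ≤⟨ +-monoʳ-≤ (length xs) (Unique-⊆⇒length-≤ (deduplicate-! (ys ∖ xs)) vs⊆ys) ⟩
    length xs + length ys ≤⟨ ≤n ⟩
    n ∎
  -- Enough candidates remain for the padding; `us` need not lie inside `zs`, so only a covering of
  -- `zs` is counted.
  n≤′ : n ≤ length us + length (zs ∖ us)
  n≤′ = begin
    n                              ≤⟨ n≤ ⟩
    length zs                      ≤⟨ Unique-⊆⇒length-≤ zs! (⊆-++-∖ zs us) ⟩
    length (us ++ (zs ∖ us))       ≡⟨ length-++ us ⟩
    length us + length (zs ∖ us) ∎

∃-∉ : ∀ {xs ys : List ℕ} → Unique xs → length ys < length xs → ∃ λ x → x ∈ xs × x ∉ ys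
∃-∉ {xs} {ys} xs! ys<xs with All.all? (_∈? ys) xs
... | yes xs⊆ys = contradiction (Unique-⊆⇒length-≤ xs! (All.lookup xs⊆ys)) (<⇒≱ ys<xs)
... | no  ¬xs⊆ys = find (All.¬All⇒Any¬ (_∈? ys) xs ¬xs⊆ys)

prefix? : ∀ {Q : List ℕ → Set} → Decidable Q → ∀ w → Dec (∃₂ λ u v → w ≡ u ++ v × Q u)
prefix? Q? []      = map′ (λ q → [] , [] , refl , q) (λ { ([] , [] , refl , q) → q }) (Q? [])
prefix? Q? (x ∷ w) = map′
  (λ { (inj₁ q) → [] , x ∷ w , refl , q
     ; (inj₂ (u , v , refl , q)) → x ∷ u , v , refl , q })
  (λ { ([] , v , refl , q) → inj₁ q
     ; (x ∷ u , v , refl , q) → inj₂ (u , v , refl , q) })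
  (Q? [] ⊎-dec prefix? (Q? ∘ (x ∷_)) w)

-- Costs and loading runs of an online policy

module _ {B k : ℕ} (P : OnlinePolicy B k) (p : Partition B) where

  costAfter-++ : ∀ w u v → costAfter P p w (u ++ v) ≡ costAfter P p w u + costAfter P p (w ++ u) v
  costAfter-++ w []      v = cong (λ w′ → costAfter P p w′ v) (sym (++-identityʳ w))
  costAfter-++ w (r ∷ u) v = begin
    c + costAfter P p (w ∷ʳ r) (u ++ v)
      ≡⟨ cong (_+_ c) (costAfter-++ (w ∷ʳ r) u v) ⟩
    c + (costAfter P p (w ∷ʳ r) u + costAfter P p (w ∷ʳ r ++ u) v)
      ≡⟨ +-assoc c _ _ ⟨
    costAfter P p w (r ∷ u) + costAfter P p (w ∷ʳ r ++ u) v
      ≡⟨ cong (λ w′ → costAfter P p w (r ∷ u) + costAfter P p w′ v) (∷ʳ-++ w r u) ⟩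
    costAfter P p w (r ∷ u) + costAfter P p (w ++ r ∷ u) v ∎
    where
    open ≡-Reasoning
    c = proj₁ (step P p w r)

  -- The last step of a nonempty history carries the bound.
  length-cache : ∀ w → length (cache P p w) ≤ k
  length-cache w with initLast w
  ... | []                       rewrite start P p = z≤n
  ... | u ∷ʳ′ r with step P p u r
  ...   | _ , hit _ _ ≤k    = ≤k
  ...   | _ , miss _ _ _ ≤k = ≤k

  missed : ∀ {w r} → r ∉ cache P p w →
           proj₁ (step P p w r) ≡ 1 × r ∈ cache P p (w ∷ʳ r)
  missed {w} {r} r∉ with step P p w r
  ... | _ , hit r∈ _ _      = contradiction r∈ r∉
  ... | _ , miss _ r∈′ _ _  = refl , r∈′

  Loaded-∷ʳ : ∀ {w x} r → Loaded P p w x → Loaded P p (w ∷ʳ r) x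
  Loaded-∷ʳ r (u , v , refl , x∈) = u , v ∷ʳ r , ++-assoc u v _ , x∈

  cached⇒Loaded : ∀ {w x} → x ∈ cache P p w → Loaded P p w x
  cached⇒Loaded {w} x∈ = w , [] , sym (++-identityʳ w) , x∈

  Loaded-requested : ∀ {w r} → ¬ Loaded P p w r → Loaded P p (w ∷ʳ r) r
  Loaded-requested ¬l = cached⇒Loaded (proj₂ (missed (¬l ∘ cached⇒Loaded)))

  loaded? : ∀ w x → Dec (Loaded P p w x)
  loaded? w x = prefix? (λ u → x ∈? cache P p u) w

  -- Items once loaded stay Loaded, so a single pass over the block suffices.
  loadingRun : ∀ b xs w → All (λ x → blockOf p x ≡ b) xs →
               (∀ x → blockOf p x ≡ b → Loaded P p w x ⊎ x ∈ xs) →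
               ∃ (LoadingRun P p b w)
  loadingRun b [] w _ loaded∨∈ =
    [] , done λ x x∈b → [ id , (λ ()) ]′ (loaded∨∈ x x∈b)
  loadingRun b (x ∷ xs) w (x∈b ∷ xs∈b) loaded∨∈ with loaded? w x
  ... | yes l = loadingRun b xs w xs∈b λ y y∈b → [ inj₁ , (λ where
          (here refl)  → inj₁ l
          (there y∈xs) → inj₂ y∈xs) ]′ (loaded∨∈ y y∈b)
  ... | no ¬l with loadingRun b xs (w ∷ʳ x) xs∈b (λ y y∈b → [ inj₁ ∘ Loaded-∷ʳ x , (λ where
          (here refl)  → inj₁ (Loaded-requested ¬l)
          (there y∈xs) → inj₂ y∈xs) ]′ (loaded∨∈ y y∈b))
  ...   | rs , run = x ∷ rs , access x∈b ¬l run

  module _ {b : ℕ} where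

    run-block : ∀ {w rs} → LoadingRun P p b w rs → All (λ x → blockOf p x ≡ b) rs
    run-block (done _)           = []
    run-block (access r∈b _ run) = r∈b ∷ run-block run

    run-unloaded : ∀ {w rs} → LoadingRun P p b w rs → All (λ x → ¬ Loaded P p w x) rs
    run-unloaded (done _)                   = []
    run-unloaded (access {r} r∈b ¬l run) =
      ¬l ∷ All.map (λ ¬l′ → ¬l′ ∘ Loaded-∷ʳ r) (run-unloaded run)

    -- A requested item counts as loaded from then on, so it cannot equal a later request of the
    -- run.
    run-unique : ∀ {w rs} → LoadingRun P p b w rs → Unique rs
    run-unique (done _)          = []
    run-unique (access _ ¬l run) =
      All.map (λ { ¬l′ refl → ¬l′ (Loaded-requested ¬l) }) (run-unloaded run) ∷ run-unique run

    run-cost : ∀ {w rs} → LoadingRun P p b w rs → costAfter P p w rs ≡ length rs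
    run-cost (done _)          = refl
    run-cost (access _ ¬l run) =
      cong₂ _+_ (proj₁ (missed (¬l ∘ cached⇒Loaded))) (run-cost run)

  -- The classical paging adversary: among more than `k` candidates one is always outside the cache.
  -- Requests may repeat, as the policy may evict an item again.
  misses : ∀ {xs} → Unique xs → k < length xs → ∀ n w →
           ∃ λ s → length s ≡ n × s ⊆ xs × costAfter P p w s ≡ n
  misses xs! k<xs zero    w = [] , refl , (λ ()) , refl
  misses xs! k<xs (suc n) w
    with r , r∈xs , r∉ ← ∃-∉ xs! (≤-<-trans (length-cache w) k<xs)
    with s , refl , s⊆xs , cost≡n ← misses xs! k<xs n (w ∷ʳ r) =
      r ∷ s , refl , (λ { (here refl) → r∈xs ; (there x∈s) → s⊆xs x∈s })
      , cong₂ _+_ (proj₁ (missed r∉)) cost≡n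

-- Offline schedules

-- Continuations stand in for schedules with a prescribed final cache.
Reaches : ∀ {B} → Partition B → ℕ → Cache → List Item → ℕ → Cache → Set
Reaches p h C w m D = ∀ {τ n} → Schedule p h D τ n → Schedule p h C (w ++ τ) (m + n)

module _ {B : ℕ} {p : Partition B} {h : ℕ} where

  Reaches-trans : ∀ {C D E u v m n} → Reaches p h C u m D → Reaches p h D v n E →
                  Reaches p h C (u ++ v) (m + n) E
  Reaches-trans {u = u} {v} {m} {n} f g {τ} {l} s =
    subst₂ (Schedule p h _) (sym (++-assoc u v τ)) (sym (+-assoc m n l)) (f (g s))

  serve-hits : ∀ {C} → length C ≤ h → ∀ {w} → All (_∈ C) w → Reaches p h C w 0 C
  serve-hits ≤h []          s = s
  serve-hits ≤h (r∈C ∷ w∈C) s = hit r∈C id ≤h ∷ serve-hits ≤h w∈C s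

  -- The offline advantage: the one miss already loads whatever `w` will ask for.
  serve-miss : ∀ {C D r w} → r ∉ C → (∀ {x} → x ∈ D → x ∈ C ⊎ blockOf p x ≡ blockOf p r) →
               length D ≤ h → All (_∈ D) (r ∷ w) → Reaches p h C (r ∷ w) 1 D
  serve-miss r∉C D⊆ ≤h (r∈D ∷ w∈D) s = miss r∉C r∈D D⊆ ≤h ∷ serve-hits ≤h w∈D s

  -- Fills the empty offline cache before the first phase. This happens once, so its cost is a
  -- constant that the asymptotic ratio ignores.
  load-upTo : ∀ n → n ≤ h → Reaches p h [] (upTo n) n (upTo n)
  load-upTo zero    _   s = s
  load-upTo (suc n) n<h = subst₂ (λ w → Reaches p h [] w (suc n)) eq eq
    (subst (λ m → Reaches p h [] (upTo n ++ n ∷ []) m (upTo n ∷ʳ n)) (+-comm n 1)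
      (Reaches-trans (load-upTo n (<⇒≤ n<h))
        (serve-miss (λ n∈ → <-irrefl refl (∈-upTo⁻ n∈)) snoc
          (≤-trans (≤-reflexive (trans (cong length eq) (length-upTo (suc n)))) n<h)
          (∈-++⁺ʳ (upTo n) (here refl) ∷ []))))
    where
    eq = upTo-∷ʳ n
    snoc : ∀ {x} → x ∈ upTo n ∷ʳ n → x ∈ upTo n ⊎ blockOf p x ≡ blockOf p n
    snoc x∈ with ∈-++⁻ (upTo n) x∈
    ... | inj₁ x∈′         = inj₁ x∈′
    ... | inj₂ (here refl) = inj₂ refl

-- The partition into intervals of `B` items

range : ℕ → ℕ → List ℕ
range i n = applyUpTo (_+_ i) n

∈-range⁺ : ∀ {i n x} → i ≤ x → x < i + n → x ∈ range i n
∈-range⁺ {i} {n} {x} i≤x x<i+n = subst (_∈ range i n) (m+[n∸m]≡n i≤x)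
  (∈-applyUpTo⁺ (_+_ i) (+-cancelˡ-< i _ _ (subst (_< i + n) (sym (m+[n∸m]≡n i≤x)) x<i+n)))

∈-range⁻ : ∀ {i n x} → x ∈ range i n → i ≤ x × x < i + n
∈-range⁻ {i} x∈ with j , j<n , refl ← ∈-applyUpTo⁻ (_+_ i) x∈ = m≤m+n i j , +-monoʳ-< i j<n

range-unique : ∀ i n → Unique (range i n)
range-unique i n = Unique.applyUpTo⁺₁ (_+_ i) n λ j<j′ _ → <⇒≢ j<j′ ∘ +-cancelˡ-≡ i _ _

module _ (B : ℕ) .{{_ : NonZero B}} where

  blockItems : ℕ → List Item
  blockItems b = range (b * B) B

  ∈-blockItems⁺ : ∀ {b x} → x ℕ./ B ≡ b → x ∈ blockItems b
  ∈-blockItems⁺ {x = x} refl = ∈-range⁺ (ℕ.m/n*n≤m x B) (begin-strict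
    x                      ≡⟨ ℕ.m≡m%n+[m/n]*n x B ⟩
    x ℕ.% B + x ℕ./ B * B  <⟨ +-monoˡ-< (x ℕ./ B * B) (ℕ.m%n<n x B) ⟩
    B + x ℕ./ B * B        ≡⟨ +-comm B _ ⟩
    x ℕ./ B * B + B ∎)
    where open ≤-Reasoning

  m*n≤o⇒m≤o/n : ∀ {m o} → m * B ≤ o → m ≤ o ℕ./ B
  m*n≤o⇒m≤o/n {m} {o} le = subst (_≤ o ℕ./ B) (ℕ.m*n/n≡m m B) (ℕ./-monoˡ-≤ B le)

  ∈-range⇒block : ∀ {b n x} → x ∈ range (b * B) (n * B) → b ≤ x ℕ./ B × x ℕ./ B < n + b
  ∈-range⇒block {b} {n} {x} x∈ with ≤x , x< ← ∈-range⁻ x∈ =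
    m*n≤o⇒m≤o/n ≤x ,
    ℕ.m<n*o⇒m/o<n (subst (x <_) (trans (+-comm (b * B) _) (sym (*-distribʳ-+ B n b))) x<)

  ∈-blockItems⁻ : ∀ {b x} → x ∈ blockItems b → x ℕ./ B ≡ b
  ∈-blockItems⁻ {b} {x} x∈
    -- A block is a range of one block, but `1 * B` unfolds to `B + 0`.
    with b≤ , ≤b ← ∈-range⇒block {n = 1}
                     (subst (λ m → x ∈ range (b * B) m) (sym (+-identityʳ B)) x∈) =
    ≤-antisym (s≤s⁻¹ ≤b) b≤

  intervals : Partition B
  intervals = record
    { blockOf    = ℕ._/ B
    ; block-size = λ b xs xs! xs∈b → subst (length xs ≤_) (length-applyUpTo _ B)
                     (Unique-⊆⇒length-≤ xs! (∈-blockItems⁺ ∘ All.lookup xs∈b))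
    }

  fullBlock : ∀ b → FullBlock intervals b
  fullBlock b = blockItems b , range-unique (b * B) B , All.tabulate ∈-blockItems⁻ ,
                length-applyUpTo _ B

  -- Expresses freshness: when it holds of a history, all blocks from `b` on are untouched.
  Below : ℕ → List Item → Set
  Below b = All (λ x → x ℕ./ B < b)

  Below-mono : ∀ {b c xs} → b ≤ c → Below b xs → Below c xs
  Below-mono b≤c = All.map (λ lt → <-≤-trans lt b≤c)

  -- Runs on fresh blocks

  module _ {k h a : ℕ} (a≤h : a ≤ h) (P : OnlinePolicy B k) (loads : LoadsBlockAfter P a) where

    private
      p = intervals

    run : ∀ b w → ∃ (LoadingRun P p b w)
    run b w = loadingRun P p b (blockItems b) w (All.tabulate ∈-blockItems⁻)
                (λ _ → inj₂ ∘ ∈-blockItems⁺)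

    -- An empty run on block 0 at the very start would mean that item 0 is already loaded, but the
    -- cache starts empty.
    a≢0 : a ≢ 0
    a≢0 refl with run 0 []
    ... | rs , rn with rs | rn | loads p 0 [] rs (fullBlock 0) [] rn
    ...   | [] | done loaded | _ with loaded 0 (ℕ.m*n/n≡m 0 B)
    ...     | [] , _ , refl , x∈ rewrite start P p with () ← x∈

    fresh-run : ∀ b w → Below b w → ∃ λ rs → length rs ≡ a × All (λ x → x ℕ./ B ≡ b) rs ×
                Unique rs × costAfter P p w rs ≡ a
    fresh-run b w w<b with rs , rn ← run b w =
      rs , len , run-block P p rn , run-unique P p rn , trans (run-cost P p rn) len
      where len = loads p b w rs (fullBlock b) (All.map <⇒≢ w<b) rn

    -- R is the part of the cache, at the end of the phase, that the last run does not account for.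
    Ready : ℕ → Cache → List Item → Set
    Ready b C R = Below b C × (∀ {x} → x ∈ R → x ℕ./ B < b → x ∈ C)

    -- The offline cache can hold an item of `R` only once its block has been requested, so before
    -- that it holds only this part of `R`.
    keep : ℕ → List Item → List Item
    keep b = filter (λ x → x ℕ./ B <? b)

    -- The miss on the first request loads the whole run together with the items of `R` in block
    -- `b`; the items of `R` in earlier blocks are still in `C`.
    serve-run : ∀ {b C R rs} → length rs ≡ a → All (λ x → x ℕ./ B ≡ b) rs → length R + a ≤ h →
                Ready b C R → Ready (suc b) (rs ++ keep (suc b) R) R ×
                              Reaches p h C rs 1 (rs ++ keep (suc b) R)
    -- The miss needs a first request, so the run must be nonempty.
    serve-run {rs = []} len = contradiction (sym len) a≢0
    serve-run {b} {C} {R} {rs@(r ∷ us)} len rs∈b@(r∈b ∷ _) R+a≤h (C<b , R⊆C) =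
      (All.++⁺ (All.map (s≤s ∘ ≤-reflexive) rs∈b) (All.all-filter (λ x → x ℕ./ B <? suc b) R)
      , λ x∈R x<b → ∈-++⁺ʳ rs (∈-filter⁺ (λ x → x ℕ./ B <? suc b) x∈R x<b))
      , serve-miss r∉C ⊆C∪b ≤h (All.tabulate ∈-++⁺ˡ)
      where
      r∉C : r ∉ C
      r∉C r∈C = <-irrefl r∈b (All.lookup C<b r∈C)
      ⊆C∪b : ∀ {x} → x ∈ rs ++ keep (suc b) R → x ∈ C ⊎ x ℕ./ B ≡ r ℕ./ B
      ⊆C∪b x∈ with ∈-++⁻ rs x∈
      ... | inj₁ x∈rs = inj₂ (trans (All.lookup rs∈b x∈rs) (sym r∈b))
      ... | inj₂ x∈′ with x∈R , x≤b ← ∈-filter⁻ (λ x → x ℕ./ B <? suc b) x∈′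
                     with m≤n⇒m<n∨m≡n (s≤s⁻¹ x≤b)
      ...   | inj₁ x<b = inj₁ (R⊆C x∈R x<b)
      ...   | inj₂ x≡b = inj₂ (trans x≡b (sym r∈b))
      ≤h : length (rs ++ keep (suc b) R) ≤ h
      ≤h = begin
        length (rs ++ keep (suc b) R)        ≡⟨ length-++ rs ⟩
        length rs + length (keep (suc b) R)
          ≤⟨ +-mono-≤ (≤-reflexive len) (length-filter (λ x → x ℕ./ B <? suc b) R) ⟩
        a + length R                         ≡⟨ +-comm a _ ⟩
        length R + a                         ≤⟨ R+a≤h ⟩
        h ∎
        where open ≤-Reasoning

    -- The order of quantifiers matters: `σ` depends on the policy alone, while `R` is chosen
    -- afterwards, because it has to contain requests that the adversary finds only after these
    -- runs.
    fresh-runs : ∀ n b w → Below b w → ∃ λ σ → costAfter P p w σ ≡ n * a × Below (n + b) σ ×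
                 (∀ {C R} → length R + a ≤ h → Ready b C R →
                  ∃ λ D → Ready (n + b) D R × Reaches p h C σ n D)
    fresh-runs zero    b w w<b = [] , refl , [] , λ {C} _ ready → C , ready , id
    fresh-runs (suc n) b w w<b
      with σ , cost-σ , σ<b , serve-σ ← fresh-runs n b w w<b
      -- The recursion splits off the last run, on block `n + b`.
      with rs , len , rs∈ , _ , cost-rs ← fresh-run (n + b) (w ++ σ)
             (All.++⁺ (Below-mono (m≤n+m b n) w<b) σ<b) =
      σ ++ rs
      , trans (costAfter-++ P p w σ rs) (trans (cong₂ _+_ cost-σ cost-rs) (+-comm (n * a) a))
      , All.++⁺ (Below-mono (n≤1+n _) σ<b) (All.map (s≤s ∘ ≤-reflexive) rs∈)
      , λ {C} {R} R+a≤h ready →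
          let D , ready′ , reaches = serve-σ {C} {R} R+a≤h ready
              ready″ , reaches′ = serve-run {rs = rs} len rs∈ R+a≤h ready′
              E = rs ++ keep (suc (n + b)) R
          in E , ready″ , subst (λ m → Reaches p h C (σ ++ rs) m E) (+-comm n 1)
                            (Reaches-trans reaches reaches′)

    -- Phases of the adversary

    -- The candidates for the final requests, with `T` the offline cache at the start of the phase.
    -- New blocks enter whole, since the miss on a block can load any of its items.
    pool : ℕ → ℕ → Cache → List Item
    pool b n T = T ++ range (b * B) (n * B)

    length-pool : ∀ b n T → length (pool b n T) ≡ length T + n * B
    length-pool b n T = trans (length-++ T) (cong (_+_ (length T)) (length-applyUpTo _ (n * B)))

    pool-unique : ∀ {b} n {T} → Unique T → Below b T → Unique (pool b n T)
    pool-unique {b} n T! T<b = Unique.++⁺ T! (range-unique (b * B) (n * B))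
      λ (v∈T , v∈) → <⇒≱ (All.lookup T<b v∈T) (proj₁ (∈-range⇒block {b} {n} v∈))

    pool-below : ∀ {b} n {T} → Below b T → Below (n + b) (pool b n T)
    pool-below {b} n T<b = All.++⁺ (Below-mono (m≤n+m b n) T<b)
      (All.tabulate (proj₂ ∘ ∈-range⇒block {b} {n}))

    -- The new blocks are numbered from `b` on, so items of `R` in older blocks come from `T`.
    pool-ready : ∀ {b} n {T R} → Below b T → R ⊆ pool b n T → Ready b T R
    pool-ready {b} n {T} T<b R⊆ = T<b , λ x∈R x<b →
      [ id , (λ x∈ → contradiction (proj₁ (∈-range⇒block {b} {n} x∈)) (<⇒≱ x<b)) ]′
        (∈-++⁻ T (R⊆ x∈R))

    -- The state after `t` phases of `n` new blocks each. A full offline cache gives the next phase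
    -- its `h + n * B` candidates. The summand `h` in `reaches` pays for the initial filling;
    -- `cost≥` does not count what the policy pays for it.
    record Configuration (n t : ℕ) : Set where
      field
        history    : List Item
        next       : ℕ
        opt        : Cache
        history<   : Below next history
        opt<       : Below next opt
        opt-unique : Unique opt
        opt-full   : length opt ≡ h
        reaches    : Reaches p h [] history (h + t * n) opt
        cost≥      : t * (n * a + (h ∸ a)) ≤ cost P p history

    initial : ∀ n → Configuration n 0
    initial n = record
      { history    = upTo h
      -- Large enough, since `x / B` is at most `x`.
      ; next       = h
      ; opt        = upTo h
      ; history<   = upTo<
      ; opt<       = upTo<
      ; opt-unique = Unique.upTo⁺ h
      ; opt-full   = length-upTo h
      ; reaches    = subst (λ m → Reaches p h [] (upTo h) m (upTo h)) (sym (+-identityʳ h))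
                       (load-upTo h ≤-refl)
      ; cost≥      = z≤n
      }
      where
      upTo< : Below h (upTo h)
      upTo< = All.tabulate λ {x} x∈ → ≤-<-trans (ℕ.m/n≤m x B) (∈-upTo⁻ x∈)

    -- The last of the `suc n` runs is treated apart, because its items `rs` stay in the offline
    -- cache until the end of the phase, next to `R`.
    advance : ∀ n {t} → k < h + suc n * B → Configuration (suc n) t → Configuration (suc n) (suc t)
    advance n {t} k< record { history = w ; next = b ; opt = T ; history< = w<b ; opt< = T<b
                            ; opt-unique = T! ; opt-full = T≡h ; reaches = reaches ; cost≥ = cost≥ }
      with σ , cost-σ , σ< , serve-σ ← fresh-runs n b w w<b
      with rs , len , rs∈ , rs! , cost-rs ← fresh-run (n + b) (w ++ σ)
             (All.++⁺ (Below-mono (m≤n+m b n) w<b) σ<)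
      with s , len-s , s⊆ , cost-s ← misses P p {pool b (suc n) T} (pool-unique (suc n) T! T<b)
             (subst (k <_) (sym (trans (length-pool b (suc n) T) (cong (_+ suc n * B) T≡h))) k<)
             (h ∸ a) ((w ++ σ) ++ rs)
      -- The last run and the final requests fit together, as `a + (h ∸ a)` is `h`. The earlier runs
      -- fit beside `R` for the same reason: `R` leaves `a` slots.
      with R , rsR! , s⊆rsR , R⊆ , len-rsR ← complete {rs} {pool b (suc n) T} s h rs!
             (pool-unique (suc n) T! T<b) s⊆
             (≤-reflexive (trans (cong₂ _+_ len len-s) (m+[n∸m]≡n a≤h)))
             (subst (h ≤_) (sym (length-pool b (suc n) T)) (m≤n⇒m≤n+o _ (≤-reflexive (sym T≡h)))) =
      record
      { history    = w ++ σ ++ rs ++ s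
      ; next       = suc n + b
      ; opt        = rs ++ R
      ; history<   = All.++⁺ (Below-mono (m≤n+m b (suc n)) w<b) (All.++⁺ (Below-mono (n≤1+n _) σ<)
                       (All.++⁺ rs< (All.anti-mono s⊆ pool<)))
      ; opt<       = All.++⁺ rs< R<
      ; opt-unique = rsR!
      ; opt-full   = len-rsR
      ; reaches    = subst (λ m → Reaches p h [] (w ++ σ ++ rs ++ s) m (rs ++ R))
                       -- The past costs `h + t * suc n`, the first `n` runs cost `n`, the last run
                       -- 1 and the final requests 0.
                       (solve 3 (λ h x n → (h :+ x) :+ (n :+ (con 1 :+ con 0)) :=
                                           h :+ ((con 1 :+ n) :+ x)) refl h (t * suc n) n)
                       (Reaches-trans reaches (Reaches-trans (proj₂ (proj₂ σ-served))
                         (Reaches-trans rs-served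
                           (serve-hits (≤-reflexive len-rsR) (All.tabulate s⊆rsR)))))
      ; cost≥      = total-cost
      }
      where
      open +-*-Solver
      pool< : Below (suc n + b) (pool b (suc n) T)
      pool< = pool-below (suc n) T<b
      rs< : Below (suc n + b) rs
      rs< = All.map (s≤s ∘ ≤-reflexive) rs∈
      R< : Below (suc n + b) R
      R< = All.anti-mono R⊆ pool<
      R+a≤h : length R + a ≤ h
      R+a≤h = ≤-reflexive (begin
        length R + a         ≡⟨ +-comm (length R) a ⟩
        a + length R         ≡⟨ cong (_+ length R) len ⟨
        length rs + length R ≡⟨ length-++ rs ⟨
        length (rs ++ R)     ≡⟨ len-rsR ⟩
        h ∎)
        where open ≡-Reasoning
      σ-served : ∃ λ D → Ready (n + b) D R × Reaches p h T σ n D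
      σ-served = serve-σ R+a≤h (pool-ready (suc n) T<b R⊆)
      rs-served : Reaches p h (proj₁ σ-served) rs 1 (rs ++ R)
      rs-served = subst (λ R′ → Reaches p h (proj₁ σ-served) rs 1 (rs ++ R′))
        -- After the last run every block of the phase has been requested, so `keep` drops nothing
        -- from `R`.
        (filter-all (λ x → x ℕ./ B <? suc (n + b)) R<)
        (proj₂ (serve-run {rs = rs} len rs∈ R+a≤h (proj₁ (proj₂ σ-served))))
      phase-cost : costAfter P p w (σ ++ rs ++ s) ≡ n * a + (a + (h ∸ a))
      phase-cost = begin
        costAfter P p w (σ ++ rs ++ s)
          ≡⟨ costAfter-++ P p w σ (rs ++ s) ⟩
        costAfter P p w σ + costAfter P p (w ++ σ) (rs ++ s)
          ≡⟨ cong₂ _+_ cost-σ (costAfter-++ P p (w ++ σ) rs s) ⟩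
        n * a + (costAfter P p (w ++ σ) rs + costAfter P p ((w ++ σ) ++ rs) s)
          ≡⟨ cong (_+_ (n * a)) (cong₂ _+_ cost-rs cost-s) ⟩
        n * a + (a + (h ∸ a)) ∎
        where open ≡-Reasoning
      total-cost : suc t * (suc n * a + (h ∸ a)) ≤ cost P p (w ++ σ ++ rs ++ s)
      total-cost = begin
        suc t * (suc n * a + (h ∸ a))
          ≡⟨ solve 4 (λ t n a r → (con 1 :+ t) :* ((con 1 :+ n) :* a :+ r) :=
                       t :* ((con 1 :+ n) :* a :+ r) :+ (n :* a :+ (a :+ r))) refl t n a (h ∸ a) ⟩
        t * (suc n * a + (h ∸ a)) + (n * a + (a + (h ∸ a)))
          ≤⟨ +-mono-≤ cost≥ (≤-reflexive (sym phase-cost)) ⟩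
        cost P p w + costAfter P p w (σ ++ rs ++ s)
          ≡⟨ costAfter-++ P p [] w (σ ++ rs ++ s) ⟨
        cost P p (w ++ σ ++ rs ++ s) ∎
        where open ≤-Reasoning

    configuration : ∀ n → k < h + suc n * B → ∀ t → Configuration (suc n) t
    configuration n k< zero    = initial (suc n)
    configuration n k< (suc t) = advance n k< (configuration n k< t)

    -- From phases to the competitive ratio

    -- Each phase adds at least `e` to the policy's cost and `q` to an offline cost, so `slope-≤`
    -- compares the two.
    competitive⇒≤ : ∀ c → Competitive P h c → ∀ n → k < h + suc n * B →
                    fromℕ (suc n * a + (h ∸ a)) ℚ.≤ c ℚ.* fromℕ (suc n)
    competitive⇒≤ c (d , competitive) n k< =
      subst (λ x → fromℕ e ℚ.≤ x ℚ.* fromℕ q) c⁺≡c e≤c⁺q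
      where
      q e : ℕ
      q = suc n
      e = suc n * a + (h ∸ a)
      -- Replacing the optimal cost by an upper bound needs a nonnegative factor.
      c⁺ : ℚ
      c⁺ = c ℚ.⊔ 0ℚ
      -- The optimal cost exists only up to double negation, but the conclusion is decidable.
      bounded : ∀ t → fromℕ (t * e) ℚ.≤ c⁺ ℚ.* fromℕ (h + t * q) ℚ.+ d
      bounded t = decidable-stable (_ ℚ.≤? _) λ ≰ → least (h + t * q + 0) (reaches []) λ
        (m , m≤ , schedule , minimal) → ≰ (begin
          fromℕ (t * e)
            ≤⟨ fromℕ-mono-≤ (subst (λ w → t * e ≤ cost P p w) (sym (++-identityʳ history)) cost≥) ⟩
          fromℕ (cost P p (history ++ []))
            ≤⟨ competitive p (history ++ []) m (schedule , minimal) ⟩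
          c ℚ.* fromℕ m ℚ.+ d
            ≤⟨ ℚ.+-monoˡ-≤ d (ℚ.*-monoʳ-≤-nonNeg (fromℕ m) {{fromℕ-nonNeg m}} (ℚ.p≤p⊔q c 0ℚ)) ⟩
          c⁺ ℚ.* fromℕ m ℚ.+ d
            ≤⟨ ℚ.+-monoˡ-≤ d (ℚ.*-monoˡ-≤-nonNeg c⁺ {{ℚ.nonNegative (ℚ.p≤q⊔p c 0ℚ)}}
                 (fromℕ-mono-≤ (≤-trans m≤ (≤-reflexive (+-identityʳ _))))) ⟩
          c⁺ ℚ.* fromℕ (h + t * q) ℚ.+ d ∎)
        where
        open Configuration (configuration n k< t)
        open ℚ.≤-Reasoning
      e≤c⁺q : fromℕ e ℚ.≤ c⁺ ℚ.* fromℕ q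
      e≤c⁺q = slope-≤ c⁺ d e q h bounded
      c⁺≡c : c⁺ ≡ c
      c⁺≡c with ℚ.⊔-sel c 0ℚ
      ... | inj₁ c⁺≡c = c⁺≡c
      -- A zero factor would force `e ≤ 0`, but `e` is at least `a`, which is positive.
      ... | inj₂ c⁺≡0 = contradiction (begin-strict
              0ℚ             <⟨ ℚ.positive⁻¹ 1ℚ ⟩
              fromℕ 1        ≤⟨ fromℕ-mono-≤ 1≤e ⟩
              fromℕ e        ≤⟨ e≤c⁺q ⟩
              c⁺ ℚ.* fromℕ q ≡⟨ cong (ℚ._* fromℕ q) c⁺≡0 ⟩
              0ℚ ℚ.* fromℕ q ≡⟨ ℚ.*-zeroˡ (fromℕ q) ⟩
              0ℚ ∎) (ℚ.<-irrefl refl)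
        where
        open ℚ.≤-Reasoning
        1≤e : 1 ≤ e
        1≤e = ≤-trans (n≢0⇒n>0 a≢0) (≤-trans (m≤m+n a (n * a)) (m≤m+n _ _))

    -- With `m = q * B`, the stated fraction is `(q * a + (h ∸ a)) / q`, the cost ratio of one
    -- phase, expanded by `B`.
    ratio≥ : ∀ m .{{_ : NonZero m}} → B ∣ m → k < h + m →
             CompetitiveRatio≥ P h (+ (a * m + B * (h ∸ a)) / m)
    ratio≥ m (divides (suc n) refl) k< c competitive =
      ℚ.*-cancelʳ-≤-pos (fromℕ m) {{fromℕ-pos m}} (begin
        (+ i / m) ℚ.* fromℕ m                ≡⟨ i/n*n≡i i m ⟩
        fromℕ i                              ≡⟨ cong fromℕ (solve 4 (λ a n B r →
            a :* (n :* B) :+ B :* r := (n :* a :+ r) :* B) refl a (suc n) B (h ∸ a)) ⟩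
        fromℕ ((suc n * a + (h ∸ a)) * B)    ≡⟨ fromℕ-* (suc n * a + (h ∸ a)) B ⟩
        fromℕ (suc n * a + (h ∸ a)) ℚ.* fromℕ B
          ≤⟨ ℚ.*-monoʳ-≤-nonNeg (fromℕ B) {{fromℕ-nonNeg B}} (competitive⇒≤ c competitive n k<) ⟩
        c ℚ.* fromℕ (suc n) ℚ.* fromℕ B      ≡⟨ ℚ.*-assoc c (fromℕ (suc n)) (fromℕ B) ⟩
        c ℚ.* (fromℕ (suc n) ℚ.* fromℕ B)    ≡⟨ cong (c ℚ.*_) (fromℕ-* (suc n) B) ⟨
        c ℚ.* fromℕ m ∎)
      where
      open ℚ.≤-Reasoning
      open +-*-Solver
      i : ℕ
      i = a * m + B * (h ∸ a)

-- A phase consists of whole blocks, so the argument runs over multiples of `B`. If `k - h + 1` is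
-- not one, rounding it up gives a bound of the same shape.
theorem4 : ∀ (B k h a : ℕ) .{{_ : NonZero B}} → a ≤ h → h ≤ k →
    (P : OnlinePolicy B k) → LoadsBlockAfter P a →
    (B ∣ suc (k ∸ h) →
    CompetitiveRatio≥ P h (+ (a * suc (k ∸ h) + B * (h ∸ a)) / suc (k ∸ h)))
    ×
    (∀ m .{{_ : NonZero m}} → B ∣ m → suc (k ∸ h) ≤ m →
    CompetitiveRatio≥ P h (+ (a * m + B * (h ∸ a)) / m))
theorem4 B k h a a≤h _ P loads =
  (λ B∣ → ratio≥ B a≤h P loads (suc (k ∸ h)) B∣ (k<h+ ≤-refl)) ,
  (λ m B∣m ≤m → ratio≥ B a≤h P loads m B∣m (k<h+ ≤m))
  where
  k<h+ : ∀ {m} → suc (k ∸ h) ≤ m → k < h + m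
  k<h+ k∸h<m = ≤-<-trans (m≤n+m∸n k h) (+-monoʳ-< h k∸h<m)
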